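{- Let $G$ be a finite simple graph. Suppose there exists an injective coloring $f$ of $S_G^2$ using exactly $\chi_i(S_G^2)$ colors such that all extreme vertices of $S_G^2$ receive the same color, and for each extreme vertex $(u,u)$, $u\in V(G)$, the color $f(u,u)$ is not assigned to any neighbor of $(u,u)$ in $S_G^2$. Then $\chi_i(S_G^n)=\chi_i(S_G^2)$ for all $n\ge 2$.
   Context: For a graph $H$, an injective $k$-coloring is a map $f:V(H)\to\{1,\dots,k\}$ such that any two distinct vertices $u,w$ with $f(u)=f(w)$ have no common neighbor; $\chi_i(H)$ is the least such $k$. For a graph $G$ and positive integer $n$, the generalized Sierpiński graph $S_G^n$ has vertex set $V(G)^n$, and $(u_1,\dots,u_n)$, $(v_1,\dots,v_n)$ are adjacent if and only if there is $d\in\{1,\dots,n\}$ with $u_i=v_i$ for $i<d$, $u_dv_d\in E(G)$, and $u_i=v_d$, $v_i=u_d$ for all $i>d$. The extreme vertices of $S_G^n$ are the vertices $(u,u,\dots,u)$ with $u\in V(G)$. -}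

module Defs where

open import Data.Fin.Base as Fin using (Fin; zero; suc; combine; quotient; remainder; finToFun; funToFin)
import Data.Fin.Properties as Fin
open import Data.Nat.Base using (ℕ; zero; suc; _≤_; _^_; z≤n; s≤s)
open import Data.Product.Base using (∃; _×_; _,_; proj₁; proj₂)
open import Data.Vec.Base using (Vec; []; _∷_; lookup; replicate)
open import Function.Base using (_∘_)
open import Function.Bundles using (_↔_; mk↔ₛ′; module Inverse)
open import Function.Properties.Inverse using (↔⇒↣)
open import Relation.Binary.Definitions using (Symmetric; Irreflexive; DecidableEquality)
  renaming (Decidable to Decidable₂)
open import Relation.Binary.PropositionalEquality
open import Relation.Nullary using (¬_; Dec; yes; no; contradiction)
open import Relation.Nullary.Decidable using (map′; _×-dec_; _→-dec_; ¬?; via-injection)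
open import Relation.Unary using (Pred; Decidable)

-- Finite simple graphs.  Decidable adjacency is part of finiteness here: it is
-- what makes χᵢ below a natural number that can be computed.
record Graph : Set₁ where
  infix 4 _~_ _~?_
  field
    V           : Set
    order       : ℕ
    enumeration : V ↔ Fin order
    _~_         : V → V → Set
    _~?_        : Decidable₂ _~_
    ~-sym       : Symmetric _~_
    ~-irrefl    : Irreflexive _≡_ _~_

  open Inverse enumeration public
    renaming (to to index; from to vertex; strictlyInverseˡ to index-vertex; strictlyInverseʳ to vertex-index)
    using ()

  _≟_ : DecidableEquality V
  _≟_ = via-injection (↔⇒↣ enumeration) Fin._≟_

  all? : ∀ {P : V → Set} → Decidable P → Dec (∀ v → P v)
  all? {P} P? = map′ (λ h v → subst P (vertex-index v) (h (index v))) (λ h i → h (vertex i))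
                     (Fin.all? (P? ∘ vertex))

  any? : ∀ {P : V → Set} → Decidable P → Dec (∃ P)
  any? {P} P? = map′ (λ (i , p) → vertex i , p)
                     (λ (v , p) → index v , subst P (sym (vertex-index v)) p)
                     (Fin.any? (P? ∘ vertex))

open Graph using (V)

------------------------------------------------------------------------
-- Injective colorings

module _ (H : Graph) where
  open Graph H hiding (V)

  CommonNeighbor : V H → V H → Set
  CommonNeighbor u w = ∃ λ z → u ~ z × w ~ z

  IsInjectiveColoring : ∀ {k} → (V H → Fin k) → Set
  IsInjectiveColoring f = ∀ u w → u ≢ w → f u ≡ f w → ¬ CommonNeighbor u w

  InjectivelyColorable : ℕ → Set
  InjectivelyColorable k = ∃ λ (f : V H → Fin k) → IsInjectiveColoring f

  isInjectiveColoring? : ∀ {k} (f : V H → Fin k) → Dec (IsInjectiveColoring f)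
  isInjectiveColoring? f = all? λ u → all? λ w →
    ¬? (u ≟ w) →-dec (f u Fin.≟ f w) →-dec ¬? (any? λ z → (u ~? z) ×-dec (w ~? z))

  injectivelyColorable? : Decidable InjectivelyColorable
  injectivelyColorable? k = map′ (λ (c , p) → decode c , p) encode
                                 (Fin.any? (isInjectiveColoring? ∘ decode))
    where
    decode : Fin (k ^ order) → V H → Fin k
    decode c v = finToFun c (index v)

    encode : InjectivelyColorable k → ∃ (IsInjectiveColoring ∘ decode)
    encode (f , p) = funToFin (f ∘ vertex) , λ u w u≢w eq →
        p u w u≢w (trans (sym (decode-encode u)) (trans eq (decode-encode w)))
      where
      decode-encode : ∀ v → decode (funToFin (f ∘ vertex)) v ≡ f v
      decode-encode v = trans (Fin.finToFun-funToFin (f ∘ vertex) (index v)) (cong f (vertex-index v))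

  order-colorable : InjectivelyColorable order
  order-colorable = index , λ u w u≢w eq _ →
    u≢w (trans (sym (vertex-index u)) (trans (cong vertex eq) (vertex-index w)))

IsLeast : (ℕ → Set) → ℕ → Set
IsLeast P k = P k × (∀ j → P j → k ≤ j)

least : ∀ {P : ℕ → Set} → Decidable P → ∀ n → P n → ∃ (IsLeast P)
least P? n       p with P? 0
least P? n       p | yes p₀ = 0 , p₀ , λ _ _ → z≤n
least P? zero    p | no ¬p₀ = contradiction p ¬p₀
least P? (suc n) p | no ¬p₀ with least (P? ∘ suc) n p
... | k , pₖ , min = suc k , pₖ , λ { zero q → contradiction q ¬p₀ ; (suc j) q → s≤s (min j q) }

χᵢ-exists : ∀ H → ∃ (IsLeast (InjectivelyColorable H))
χᵢ-exists H = least (injectivelyColorable? H) (Graph.order H) (order-colorable H)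

χᵢ : Graph → ℕ
χᵢ H = proj₁ (χᵢ-exists H)

χᵢ-isLeast : ∀ H → IsLeast (InjectivelyColorable H) (χᵢ H)
χᵢ-isLeast H = proj₂ (χᵢ-exists H)

------------------------------------------------------------------------
-- Generalized Sierpiński graphs

Vec-enumeration : ∀ {A : Set} {m} → A ↔ Fin m → ∀ n → Vec A n ↔ Fin (m ^ n)
Vec-enumeration {A} {m} e n = mk↔ₛ′ code (decode n) (code-decode n) decode-code
  where
  open Inverse e

  code : ∀ {n} → Vec A n → Fin (m ^ n)
  code []       = zero
  code (x ∷ xs) = combine (to x) (code xs)

  decode : ∀ n → Fin (m ^ n) → Vec A n
  decode zero    _ = []
  decode (suc n) c = from (quotient (m ^ n) c) ∷ decode n (remainder {m} (m ^ n) c)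

  code-decode : ∀ n c → code (decode n c) ≡ c
  code-decode zero    zero = refl
  code-decode (suc n) c    = trans
    (cong₂ combine (strictlyInverseˡ _) (code-decode n _))
    (Fin.combine-remQuot {m} (m ^ n) c)

  decode-code : ∀ {n} (xs : Vec A n) → decode n (code xs) ≡ xs
  decode-code []       = refl
  decode-code (x ∷ xs) = cong₂ _∷_
    (trans (cong (from ∘ proj₁) (Fin.remQuot-combine (to x) (code xs))) (strictlyInverseʳ x))
    (trans (cong (decode _ ∘ proj₂) (Fin.remQuot-combine (to x) (code xs))) (decode-code xs))

module _ (G : Graph) where
  open Graph G hiding (V)

  SierpińskiAdjacent : ∀ {n} → Vec (V G) n → Vec (V G) n → Set
  SierpińskiAdjacent {n} u v = ∃ λ (d : Fin n) →
      (∀ i → i Fin.< d → lookup u i ≡ lookup v i)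
    × lookup u d ~ lookup v d
    × (∀ i → d Fin.< i → lookup u i ≡ lookup v d × lookup v i ≡ lookup u d)

  -- For n = 0, outside the range considered in the literature, this is a
  -- single vertex.
  Sierpiński : ℕ → Graph
  Sierpiński n = record
    { V           = Vec (V G) n
    ; order       = order ^ n
    ; enumeration = Vec-enumeration enumeration n
    ; _~_         = SierpińskiAdjacent
    ; _~?_        = λ u v → Fin.any? λ d →
        Fin.all? (λ i → (i Fin.<? d) →-dec (lookup u i ≟ lookup v i))
        ×-dec (lookup u d ~? lookup v d)
        ×-dec Fin.all? (λ i → (d Fin.<? i) →-dec
                ((lookup u i ≟ lookup v d) ×-dec (lookup v i ≟ lookup u d)))
    ; ~-sym       = λ (d , pre , e , post) →
        d , (λ i i<d → sym (pre i i<d)) , ~-sym e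
          , λ i d<i → proj₂ (post i d<i) , proj₁ (post i d<i)
    ; ~-irrefl    = λ { refl (_ , _ , e , _) → ~-irrefl refl e }
    }

  extreme : ∀ n → V G → V (Sierpiński n)
  extreme n u = replicate n u

{-# OPTIONS --safe #-}

-- An edge of S_G^(n+1) either lies inside one of the copies a·S_G^n or is the
-- bridge joining a b…b to b a…a, whose ends are extreme in their copies.  So
-- colouring every copy alike stays injective: a vertex lies on at most one
-- bridge, the far end of that bridge has the common extreme colour, and the
-- neighbours inside the copy avoid it.  Conversely an injective colouring of
-- S_G^(n+1) restricts to any one copy.
module Submission where

open import Defs
open import Data.Fin.Base using (Fin; zero; suc)
open import Data.Nat.Base using (ℕ; zero; suc; _≤_; _≥_; z≤n; s≤s; z<s; s<s; s<s⁻¹)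
open import Data.Nat.Properties using (≤-antisym)
open import Data.Product.Base using (∃; _×_; _,_; proj₁; proj₂)
open import Data.Sum.Base using (_⊎_; inj₁; inj₂)
open import Data.Unit.Base using (tt)
open import Data.Vec.Base using (Vec; []; _∷_; head; tail; lookup; replicate)
open import Data.Vec.Properties using (∷-injectiveˡ; ∷-injectiveʳ)
open import Function.Base using (_∘_)
open import Function.Definitions using (Surjective)
open import Relation.Binary.PropositionalEquality
  using (_≡_; _≢_; refl; sym; trans; cong; cong₂)
open import Relation.Nullary using (yes; no; contradiction)

lookup-constant⇒replicate : ∀ {A : Set} {n} {a : A} (u : Vec A n) →
                            (∀ i → lookup u i ≡ a) → u ≡ replicate n a
lookup-constant⇒replicate []      _ = refl
lookup-constant⇒replicate (_ ∷ u) p =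
  cong₂ _∷_ (p zero) (lookup-constant⇒replicate u (p ∘ suc))

χᵢ-colorable : ∀ H → InjectivelyColorable H (χᵢ H)
χᵢ-colorable H = proj₁ (χᵢ-isLeast H)

χᵢ-least : ∀ H {k} → InjectivelyColorable H k → χᵢ H ≤ k
χᵢ-least H = proj₂ (χᵢ-isLeast H) _

module _ (G : Graph) where
  open Graph G

  Bridge : ∀ {n} → V → Vec V n → V → Vec V n → Set
  Bridge {n} a u b v = a ~ b × u ≡ replicate n b × v ≡ replicate n a

  -- The position `d` decides: at `zero` every later letter is swapped, so both tails are constant;
  -- at a successor the first letters agree and `d` moves into the tails.
  ∷-adjacent⁻ : ∀ {n a b} {u v : Vec V n} → SierpińskiAdjacent G (a ∷ u) (b ∷ v) →
                (a ≡ b × SierpińskiAdjacent G u v) ⊎ Bridge a u b v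
  ∷-adjacent⁻ {u = u} {v} (zero , _ , a~b , post) = inj₂
    ( a~b
    , lookup-constant⇒replicate u (λ i → proj₁ (post (suc i) z<s))
    , lookup-constant⇒replicate v (λ i → proj₂ (post (suc i) z<s)))
  ∷-adjacent⁻ (suc d , pre , e , post) = inj₁
    (pre zero z<s , d , (λ i i<d → pre (suc i) (s<s i<d)) , e , λ i d<i → post (suc i) (s<s d<i))

  ∷-adjacent⁺ : ∀ {n} a {u v : Vec V n} → SierpińskiAdjacent G u v →
                SierpińskiAdjacent G (a ∷ u) (a ∷ v)
  ∷-adjacent⁺ a (d , pre , e , post) =
      suc d
    , (λ { zero _ → refl ; (suc i) i<d → pre i (s<s⁻¹ i<d) })
    , e
    , (λ { (suc i) d<i → post i (s<s⁻¹ d<i) })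

  -- The invariant of the induction on `n`: the last two conditions control colours at the ends of
  -- bridges, where injectivity within a copy says nothing.
  IsExtremeColoring : ∀ n {k} → (Vec V n → Fin k) → Set
  IsExtremeColoring n f =
      IsInjectiveColoring (Sierpiński G n) f
    × (∀ u v → f (extreme G n u) ≡ f (extreme G n v))
    × (∀ u x → SierpińskiAdjacent G (extreme G n u) x → f x ≢ f (extreme G n u))

  tail-coloring : ∀ {n k} {f : Vec V (suc n) → Fin k} →
                  IsExtremeColoring (suc n) f → IsExtremeColoring (suc (suc n)) (f ∘ tail)
  tail-coloring {n} {f = f} (inj , same , avoid) = inj′ , same , avoid′
    where
    -- The bridge makes `w` the extreme vertex of `a` and `u` that of `c`. As `v` is a neighbour of
    -- `w`, `avoid` separates `f v` from `f w`, while `same` gives `f w` the colour `f u`.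
    bridge-vs-copy : ∀ {a c} {u v w : Vec V (suc n)} →
                     Bridge a u c w → SierpińskiAdjacent G v w → f u ≢ f v
    bridge-vs-copy {a} {c = c} {v = v} (_ , refl , refl) v~w fu≡fv =
      avoid a v (Graph.~-sym (Sierpiński G (suc n)) {v} {extreme G (suc n) a} v~w) (trans (sym fu≡fv) (same c a))

    inj′ : IsInjectiveColoring (Sierpiński G (suc (suc n))) (f ∘ tail)
    inj′ (a ∷ u) (b ∷ v) x≢y eq (c ∷ w , x~z , y~z)
      with ∷-adjacent⁻ {u = u} x~z | ∷-adjacent⁻ {u = v} y~z
    ... | inj₁ (refl , u~w) | inj₁ (refl , v~w) = inj u v (x≢y ∘ cong (c ∷_)) eq (w , u~w , v~w)
    ... | inj₁ (refl , u~w) | inj₂ bridge       = bridge-vs-copy bridge u~w (sym eq)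
    ... | inj₂ bridge       | inj₁ (refl , v~w) = bridge-vs-copy bridge v~w eq
    -- Two bridges at `c ∷ w` make `w` constantly `a` and constantly `b`; its length is positive, so
    -- `a ≡ b` and the two vertices coincide.
    ... | inj₂ (_ , refl , refl) | inj₂ (_ , refl , w≡) =
      x≢y (cong (_∷ replicate (suc n) c) (∷-injectiveˡ w≡))

    avoid′ : ∀ a x → SierpińskiAdjacent G (extreme G (suc (suc n)) a) x →
             f (tail x) ≢ f (extreme G (suc n) a)
    avoid′ a (b ∷ v) e with ∷-adjacent⁻ {u = replicate (suc n) a} {v} e
    ... | inj₁ (_ , u~v)     = avoid a v u~v
    -- No bridge starts at an extreme vertex: its tail would be constant in both `a` and `b`, making
    -- `a ~ b` a loop.
    ... | inj₂ (a~b , u≡ , _) = contradiction a~b (~-irrefl (∷-injectiveˡ u≡))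

  colorable-pred : ∀ {n k} → InjectivelyColorable (Sierpiński G (suc (suc n))) k →
                   InjectivelyColorable (Sierpiński G (suc n)) k
  colorable-pred (f , inj) with any? (λ _ → yes tt)
  ... | yes (a , _) = f ∘ (a ∷_) , λ u w u≢w eq (z , u~z , w~z) →
    inj (a ∷ u) (a ∷ w) (u≢w ∘ ∷-injectiveʳ) eq (a ∷ z , ∷-adjacent⁺ a {u} u~z , ∷-adjacent⁺ a {w} w~z)
  -- If `G` has no vertices, there are no words of positive length, and the colouring is vacuous
  -- even for `k` equal to 0.
  ... | no empty = (λ u → contradiction (head u , tt) empty)
                 , λ u → contradiction (head u , tt) empty

  extreme-coloring : ∀ {k} → ∃ (IsExtremeColoring 2 {k}) →
                     ∀ m → ∃ (IsExtremeColoring (suc (suc m)) {k})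
  extreme-coloring base zero    = base
  extreme-coloring base (suc m) with extreme-coloring base m
  ... | f , good = f ∘ tail , tail-coloring good

  extreme⇒colorable : ∀ {n k} → ∃ (IsExtremeColoring n {k}) →
                      InjectivelyColorable (Sierpiński G n) k
  extreme⇒colorable (f , inj , _) = f , inj

  colorable-2 : ∀ m {k} → InjectivelyColorable (Sierpiński G (suc (suc m))) k →
                InjectivelyColorable (Sierpiński G 2) k
  colorable-2 zero    c = c
  colorable-2 (suc m) c = colorable-2 m (colorable-pred c)

mainTheorem2 : (G : Graph) →
    (∃ λ (f : Graph.V (Sierpiński G 2) → Fin (χᵢ (Sierpiński G 2))) →
    IsInjectiveColoring (Sierpiński G 2) f
    × Surjective _≡_ _≡_ f
    × (∀ u v → f (extreme G 2 u) ≡ f (extreme G 2 v))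
    × (∀ u x → Graph._~_ (Sierpiński G 2) (extreme G 2 u) x → f x ≢ f (extreme G 2 u))) →
    ∀ (n : ℕ) → n ≥ 2 → χᵢ (Sierpiński G n) ≡ χᵢ (Sierpiński G 2)
mainTheorem2 G (f , inj , _ , same , avoid) (suc (suc m)) (s≤s (s≤s z≤n)) = ≤-antisym
  (χᵢ-least (Sierpiński G (suc (suc m)))
    (extreme⇒colorable G (extreme-coloring G (f , inj , same , avoid) m)))
  -- For the lower bound, an optimal colouring of the larger graph is restricted one letter at a
  -- time down to length 2.
  (χᵢ-least (Sierpiński G 2) (colorable-2 G m (χᵢ-colorable (Sierpiński G (suc (suc m))))))
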